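{- For every odd integer $n\geq 3$ and every integer $m\geq 2$, the graph $mW_n$ (the disjoint union of $m$ copies of the wheel $W_n$) is $C_3$-supermagic.
   Context: All graphs are finite and simple. For a graph $H$, a graph $G=(V,E)$ has an $H$-covering if every edge of $G$ belongs to a subgraph of $G$ isomorphic to $H$. For such $G$, an $H$-magic labeling is a bijection $\lambda: V\cup E\to\{1,2,\dots,|V|+|E|\}$ for which there is a constant $c$ such that for every subgraph $H'=(V',E')$ of $G$ isomorphic to $H$, $\sum_{v\in V'}\lambda(v)+\sum_{e\in E'}\lambda(e)=c$. It is $H$-supermagic if moreover $\{\lambda(v):v\in V\}=\{1,\dots,|V|\}$; $G$ is $H$-supermagic if it admits such a labeling. $C_k$ is the cycle of length $k$. $mG$ denotes the disjoint union of $m$ copies of $G$. The wheel $W_n=K_1+C_n$ has vertices $c,v_1,\dots,v_n$ and edges $cv_i$ ($1\le i\le n$) and $v_iv_{i+1}$ ($1\le i\le n$, indices modulo $n$). -}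

module Defs where

open import Algebra.Properties.CommutativeMonoid.Sum using (sum)
open import Data.Bool.Base using (Bool; T; if_then_else_)
open import Data.Bool.Properties using (T-irrelevant)
open import Data.Empty using (⊥-elim)
open import Data.Fin.Base using (Fin; toℕ)
open import Data.Fin.Properties using (toℕ-fromℕ<; toℕ-injective; toℕ<n; 1↔⊤; +↔⊎; *↔×)
open import Data.Nat.Base
open import Data.Nat.DivMod
open import Data.Nat.Properties
open import Data.Product.Base using (Σ; ∃; _×_; _,_; proj₁; proj₂; map)
open import Data.Product.Function.NonDependent.Propositional using (_×-↔_)
open import Data.Sum.Base using (_⊎_; inj₁; inj₂)
open import Data.Sum.Function.Propositional using (_⊎-↔_)
open import Data.Unit.Base using (⊤; tt)
open import Function.Base using (_∘_)
open import Function.Bundles using (_↔_; _⤖_; _⇔_; Inverse; Bijection)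
open import Function.Properties.Inverse using (↔-refl; ↔-sym; ↔-trans)
open import Relation.Binary.PropositionalEquality
open import Relation.Nullary.Negation using (¬_)
open import Relation.Nullary.Decidable using (yes; no)

------------------------------------------------------------------------
-- Simple graphs

-- An edge is listed with its two ends in some order; the order carries no
-- meaning, since Joins ignores it.  By `simple`, an edge is determined by
-- its unordered pair of ends.
record Graph : Set₁ where
  field
    V E  : Set
    ends : E → V × V

  Joins : E → V → V → Set
  Joins e u v = ends e ≡ (u , v) ⊎ ends e ≡ (v , u)

  field
    loopless : ∀ {e v} → ¬ Joins e v v
    simple   : ∀ {e e′ u v} → Joins e u v → Joins e′ u v → e ≡ e′

  Adjacent : V → V → Set
  Adjacent u v = ∃ λ e → Joins e u v

record FiniteGraph : Set₁ where
  field
    graph      : Graph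
  open Graph graph public
  field
    order size : ℕ
    vertices   : Fin order ↔ V
    edges      : Fin size ↔ E

record _≅_ (G H : Graph) : Set where
  private
    module G = Graph G
    module H = Graph H
  field
    bijection : G.V ↔ H.V
  open Inverse bijection using (to)
  field
    adjacency : ∀ u v → G.Adjacent u v ⇔ H.Adjacent (to u) (to v)

-- Subsets of a finite set are given by their characteristic functions.
record Subgraph (G : Graph) : Set where
  open Graph G
  field
    inV    : V → Bool
    inE    : E → Bool
    closed : ∀ e → T (inE e) → T (inV (proj₁ (ends e))) × T (inV (proj₂ (ends e)))

module _ {A : Set} {P : A → Bool} where

  Σ-T-≡ : {x y : Σ A (T ∘ P)} → proj₁ x ≡ proj₁ y → x ≡ y
  Σ-T-≡ {x , p} {_ , q} refl = cong (x ,_) (T-irrelevant p q)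

asGraph : {G : Graph} → Subgraph G → Graph
asGraph {G} S = record
  { V        = Σ V (T ∘ inV)
  ; E        = Σ E (T ∘ inE)
  ; ends     = ends′
  ; loopless = λ {e} j → loopless (joins e j)
  ; simple   = λ {e} {e′} j j′ → Σ-T-≡ (simple (joins e j) (joins e′ j′))
  }
  where
  open Graph G
  open Subgraph S

  ends′ : Σ E (T ∘ inE) → Σ V (T ∘ inV) × Σ V (T ∘ inV)
  ends′ (e , p) = (proj₁ (ends e) , proj₁ (closed e p))
                , (proj₂ (ends e) , proj₂ (closed e p))

  joins : ∀ e {u v} → ends′ e ≡ (u , v) ⊎ ends′ e ≡ (v , u) →
          Joins (proj₁ e) (proj₁ u) (proj₁ v)
  joins e (inj₁ q) = inj₁ (cong (map proj₁ proj₁) q)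
  joins e (inj₂ q) = inj₂ (cong (map proj₁ proj₁) q)

------------------------------------------------------------------------
-- Supermagic labelings

HasCovering : FiniteGraph → FiniteGraph → Set
HasCovering H G =
  ∀ (e : E) → ∃ λ (S : Subgraph graph) → T (Subgraph.inE S e) × asGraph S ≅ FiniteGraph.graph H
  where open FiniteGraph G

∑ : ∀ {n} {A : Set} → Fin n ↔ A → (A → ℕ) → ℕ
∑ enum f = sum +-0-commutativeMonoid (f ∘ Inverse.to enum)

module _ (G : FiniteGraph) where
  open FiniteGraph G

  Labeling : Set
  Labeling = (V ⊎ E) ⤖ Fin (order + size)

  -- Fin (order + size) is {0, …, order + size − 1}, hence the shift.
  label : Labeling → V ⊎ E → ℕ
  label ℓ x = suc (toℕ (Bijection.to ℓ x))

  weight : Labeling → Subgraph graph → ℕ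
  weight ℓ S =
      ∑ vertices (λ v → if inV v then label ℓ (inj₁ v) else 0)
    + ∑ edges    (λ e → if inE e then label ℓ (inj₂ e) else 0)
    where open Subgraph S

  IsMagic : FiniteGraph → Labeling → Set
  IsMagic H ℓ = ∃ λ c → ∀ (S : Subgraph graph) →
    asGraph S ≅ FiniteGraph.graph H → weight ℓ S ≡ c

  VerticesFirst : Labeling → Set
  VerticesFirst ℓ = ∀ k → (∃ λ v → label ℓ (inj₁ v) ≡ k) ⇔ (1 ≤ k × k ≤ order)

IsSupermagic : FiniteGraph → FiniteGraph → Set
IsSupermagic H G =
  HasCovering H G × ∃ λ (ℓ : Labeling G) → IsMagic G H ℓ × VerticesFirst G ℓ

------------------------------------------------------------------------
-- Cycles

next : ∀ {n} → Fin n → Fin n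
next {suc n} i = suc (toℕ i) mod suc n

toℕ-next : ∀ {n} (i : Fin (suc n)) → toℕ (next i) ≡ suc (toℕ i) % suc n
toℕ-next {n} i = toℕ-fromℕ< (m%n<n (suc (toℕ i)) (suc n))

private
  shift-≢ : ∀ {n} k (i : Fin (suc n)) → 0 < k → k < suc n → (k + toℕ i) % suc n ≢ toℕ i
  shift-≢ {n} k i 0<k k<n eq with k + toℕ i <? suc n
  ... | yes lt = <⇒≢ (m<n+m (toℕ i) 0<k) (sym (trans (sym (m<n⇒m%n≡m lt)) eq))
  ... | no  ge = <⇒≢ k<n (+-cancelʳ-≡ (toℕ i) k (suc n)
                   (trans (sym (m∸n+n≡m n≤k+i))
                     (trans (cong (_+ suc n) wrapped) (+-comm (toℕ i) (suc n)))))
    where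
    n≤k+i : suc n ≤ k + toℕ i
    n≤k+i = ≮⇒≥ ge

    small : k + toℕ i ∸ suc n < suc n
    small = +-cancelʳ-< (suc n) _ _
      (subst (_< suc n + suc n) (sym (m∸n+n≡m n≤k+i)) (+-mono-< k<n (toℕ<n i)))

    wrapped : k + toℕ i ∸ suc n ≡ toℕ i
    wrapped = trans (sym (m<n⇒m%n≡m small)) (trans (m≤n⇒[n∸m]%m≡n%m n≤k+i) eq)

next-≢ : ∀ {n} → 2 ≤ n → (i : Fin n) → next i ≢ i
next-≢ {suc n} 2≤n i eq =
  shift-≢ 1 i (s≤s z≤n) 2≤n (trans (sym (toℕ-next i)) (cong toℕ eq))

next²-≢ : ∀ {n} → 3 ≤ n → (i : Fin n) → next (next i) ≢ i
next²-≢ {suc n} 3≤n i eq = shift-≢ 2 i (s≤s z≤n) 3≤n (begin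
  (2 + toℕ i) % N                    ≡⟨ %-distribˡ-+ 1 (1 + toℕ i) N ⟩
  (1 % N + (1 + toℕ i) % N) % N      ≡⟨ cong (λ x → (1 % N + x) % N) (m%n%n≡m%n (1 + toℕ i) N) ⟨
  (1 % N + (1 + toℕ i) % N % N) % N  ≡⟨ %-distribˡ-+ 1 ((1 + toℕ i) % N) N ⟨
  (1 + (1 + toℕ i) % N) % N          ≡⟨ cong (λ x → suc x % N) (toℕ-next i) ⟨
  suc (toℕ (next i)) % N             ≡⟨ toℕ-next (next i) ⟨
  toℕ (next (next i))                ≡⟨ cong toℕ eq ⟩
  toℕ i                              ∎)
  where
  open ≡-Reasoning
  N = suc n

C : (n : ℕ) → 3 ≤ n → FiniteGraph
C n 3≤n = record
  { graph    = record
    { V        = Fin n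
    ; E        = Fin n
    ; ends     = ends
    ; loopless = loopless
    ; simple   = simple
    }
  ; order    = n
  ; size     = n
  ; vertices = ↔-refl
  ; edges    = ↔-refl
  }
  where
  ends : Fin n → Fin n × Fin n
  ends i = i , next i

  Joins : Fin n → Fin n → Fin n → Set
  Joins i u v = ends i ≡ (u , v) ⊎ ends i ≡ (v , u)

  irrefl : ∀ {i v} → ends i ≢ (v , v)
  irrefl {i} p =
    next-≢ (<⇒≤ 3≤n) i (trans (cong proj₂ p) (sym (cong proj₁ p)))

  loopless : ∀ {i v} → ¬ Joins i v v
  loopless (inj₁ p) = irrefl p
  loopless (inj₂ p) = irrefl p

  antisym : ∀ {i j u v} → ends i ≡ (u , v) → ends j ≢ (v , u)
  antisym {i} {j} p q = next²-≢ 3≤n i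
    (trans (cong next (trans (cong proj₂ p) (sym (cong proj₁ q))))
           (trans (cong proj₂ q) (sym (cong proj₁ p))))

  simple : ∀ {i j u v} → Joins i u v → Joins j u v → i ≡ j
  simple (inj₁ p) (inj₁ q) = trans (cong proj₁ p) (sym (cong proj₁ q))
  simple (inj₁ p) (inj₂ q) = ⊥-elim (antisym p q)
  simple (inj₂ p) (inj₁ q) = ⊥-elim (antisym p q)
  simple (inj₂ p) (inj₂ q) = trans (cong proj₁ p) (sym (cong proj₁ q))

------------------------------------------------------------------------
-- Wheels and disjoint unions

-- inj₁ tt is the added vertex; the edge inj₁ v joins it to v.
K₁+_ : FiniteGraph → FiniteGraph
K₁+ G = record
  { graph    = record
    { V        = ⊤ ⊎ G.V
    ; E        = G.V ⊎ G.E
    ; ends     = ends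
    ; loopless = loopless
    ; simple   = simple
    }
  ; order    = 1 + G.order
  ; size     = G.order + G.size
  ; vertices = ↔-trans (+↔⊎ {1}) (1↔⊤ ⊎-↔ G.vertices)
  ; edges    = ↔-trans +↔⊎ (G.vertices ⊎-↔ G.edges)
  }
  where
  module G = FiniteGraph G

  ends : G.V ⊎ G.E → (⊤ ⊎ G.V) × (⊤ ⊎ G.V)
  ends (inj₁ v) = inj₁ tt , inj₂ v
  ends (inj₂ e) = map inj₂ inj₂ (G.ends e)

  Joins : G.V ⊎ G.E → ⊤ ⊎ G.V → ⊤ ⊎ G.V → Set
  Joins e u v = ends e ≡ (u , v) ⊎ ends e ≡ (v , u)

  strip : ∀ {p : G.V × G.V} {u v} → map inj₂ inj₂ p ≡ (inj₂ {A = ⊤} u , inj₂ {A = ⊤} v) → p ≡ (u , v)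
  strip refl = refl

  joins : ∀ {e u v} → Joins (inj₂ e) (inj₂ u) (inj₂ v) → G.Joins e u v
  joins (inj₁ p) = inj₁ (strip p)
  joins (inj₂ p) = inj₂ (strip p)

  loopless : ∀ {e v} → ¬ Joins e v v
  loopless {inj₁ _} (inj₁ ())
  loopless {inj₁ _} (inj₂ ())
  loopless {inj₂ e} {inj₁ _} (inj₁ ())
  loopless {inj₂ e} {inj₁ _} (inj₂ ())
  loopless {inj₂ e} {inj₂ v} j = G.loopless (joins j)

  simple : ∀ {e e′ u v} → Joins e u v → Joins e′ u v → e ≡ e′
  simple {inj₁ _} {inj₁ _} (inj₁ refl) (inj₁ refl) = refl
  simple {inj₁ _} {inj₁ _} (inj₁ refl) (inj₂ ())
  simple {inj₁ _} {inj₁ _} (inj₂ refl) (inj₁ ())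
  simple {inj₁ _} {inj₁ _} (inj₂ refl) (inj₂ refl) = refl
  simple {inj₁ _} {inj₂ _} (inj₁ refl) (inj₁ ())
  simple {inj₁ _} {inj₂ _} (inj₁ refl) (inj₂ ())
  simple {inj₁ _} {inj₂ _} (inj₂ refl) (inj₁ ())
  simple {inj₁ _} {inj₂ _} (inj₂ refl) (inj₂ ())
  simple {inj₂ _} {inj₁ _} (inj₁ ()) (inj₁ refl)
  simple {inj₂ _} {inj₁ _} (inj₁ ()) (inj₂ refl)
  simple {inj₂ _} {inj₁ _} (inj₂ ()) (inj₁ refl)
  simple {inj₂ _} {inj₁ _} (inj₂ ()) (inj₂ refl)
  simple {inj₂ _} {inj₂ _} {inj₁ _} (inj₁ ()) _
  simple {inj₂ _} {inj₂ _} {inj₁ _} (inj₂ ()) _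
  simple {inj₂ _} {inj₂ _} {inj₂ _} {inj₁ _} (inj₁ ()) _
  simple {inj₂ _} {inj₂ _} {inj₂ _} {inj₁ _} (inj₂ ()) _
  simple {inj₂ _} {inj₂ _} {inj₂ _} {inj₂ _} j j′ =
    cong inj₂ (G.simple (joins j) (joins j′))

W : (n : ℕ) → 3 ≤ n → FiniteGraph
W n 3≤n = K₁+ (C n 3≤n)

infixr 7 _·_

_·_ : ℕ → FiniteGraph → FiniteGraph
m · G = record
  { graph    = record
    { V        = Fin m × G.V
    ; E        = Fin m × G.E
    ; ends     = ends
    ; loopless = λ j → G.loopless (joins j)
    ; simple   = λ j j′ → cong₂ _,_ (trans (copy j) (sym (copy j′))) (G.simple (joins j) (joins j′))
    }
  ; order    = m * G.order
  ; size     = m * G.size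
  ; vertices = ↔-trans *↔× (↔-refl ×-↔ G.vertices)
  ; edges    = ↔-trans *↔× (↔-refl ×-↔ G.edges)
  }
  where
  module G = FiniteGraph G

  ends : Fin m × G.E → (Fin m × G.V) × (Fin m × G.V)
  ends (k , e) = (k , proj₁ (G.ends e)) , (k , proj₂ (G.ends e))

  Joins : Fin m × G.E → Fin m × G.V → Fin m × G.V → Set
  Joins e u v = ends e ≡ (u , v) ⊎ ends e ≡ (v , u)

  joins : ∀ {e u v} → Joins e u v → G.Joins (proj₂ e) (proj₂ u) (proj₂ v)
  joins (inj₁ p) = inj₁ (cong (map proj₂ proj₂) p)
  joins (inj₂ p) = inj₂ (cong (map proj₂ proj₂) p)

  copy : ∀ {e u v} → Joins e u v → proj₁ e ≡ proj₁ u
  copy (inj₁ p) = cong (proj₁ ∘ proj₁) p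
  copy (inj₂ p) = cong (proj₁ ∘ proj₂) p

{-# OPTIONS --safe #-}

-- A copy of C₃ in m W_n is either a fan triangle {c, v_i, v_(i+1)} or, when n = 3,
-- the rim of a W₃ = K₄, and its weight is the sum of six labels.
--
-- Let n = 2q + 1 > 3 and let f and g be the permutations f x = x/2, g x = (x − 1)/2
-- of ℤ/n, with representatives in [0, n).  As integers, f x + g x = q + x and
-- f i + f (i+1) = q + (i+1), where i+1 is reduced modulo n.  Giving v_i and c v_i the
-- digits f (f i) and g (f i) thus turns the sum over two consecutive i into a constant
-- plus i+1, which the digit n − 1 − (i+1) of v_i v_(i+1) cancels.  The second digit,
-- in base m, is the number k of the copy on vertices and m − 1 − k on edges.
--
-- For n = 3 write m = 2t + 3u.  A labeling of five copies of K₄ found by computer is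
-- blown up: every label of two of the copies becomes a block of t consecutive labels,
-- every label of the other three a block of u, used increasingly on vertices and
-- decreasingly on edges.  The weights are linear in t and u, and the five copies are
-- such that they do not depend on the triangle.
module Submission where

open import Defs
open import Data.Bool using (Bool; true; false; T; if_then_else_)
open import Data.Empty using (⊥-elim)
open import Data.Fin using (Fin; zero; suc; toℕ; fromℕ<; punchOut)
open import Data.Fin.Patterns
open import Data.Fin.Properties using (_≟_; all?; any?; toℕ<n; toℕ-injective; toℕ-fromℕ<; fromℕ<-injective; <⇒notInjective; punchOut-injective; +↔⊎)
open import Data.List using (List; []; _∷_; allFin)
import Data.List as List
open import Data.List.Membership.Propositional using (_∈_)
import Data.List.Membership.DecPropositional as DecMembership
import Data.List.Relation.Unary.All as All
open import Data.List.Relation.Unary.AllPairs using (_∷_)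
open import Data.List.Relation.Unary.Any using (here; there)
open import Data.List.Relation.Unary.Unique.Propositional using (Unique)
open import Data.List.Relation.Unary.Unique.Propositional.Properties using (allFin⁺)
open import Data.Nat as ℕ using (ℕ; suc; _+_; _*_; _∸_; _≤_; _<_; _<?_; _/_; _%_; s≤s; z≤n)
open import Data.Nat.DivMod using (m<n⇒m%n≡m; n%n≡0; m≡m%n+[m/n]*n)
open import Data.Nat.ListAction using () renaming (sum to sumₗ)
open import Data.Nat.Properties hiding (_≟_)
open import Data.Nat.Tactic.RingSolver using (solve-∀)
open import Algebra.Properties.CommutativeMonoid.Sum +-0-commutativeMonoid using (sum; ∑-comm; sum-cong-≗)
open import Data.Product using (∃; ∃₂; _×_; _,_; proj₁; proj₂; map)
import Data.Product.Properties as Product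
open import Data.Sum using (_⊎_; inj₁; inj₂; [_,_]′)
open import Data.Sum.Function.Propositional using (_⊎-↔_)
import Data.Sum.Properties as Sum
open import Data.Unit using (⊤; tt)
import Data.Unit.Properties as Unit
open import Function using (_∘_; _↔_; mk⇔; mk↔ₛ′; mk⤖; Inverse; Injection; Injective; Equivalence)
open import Function.Properties.Inverse using (↔-trans; ↔⇒↣)
open import Relation.Binary.Definitions using (DecidableEquality)
open import Relation.Binary.PropositionalEquality
open import Relation.Nullary using (¬_; Dec; yes; no; does; contradiction)
open import Relation.Nullary.Decidable using (⌊_⌋; from-yes; toWitness; fromWitness)

-- Finite sums and labelings

sum-zero : ∀ {n} (t : Fin n → ℕ) → (∀ i → t i ≡ 0) → sum t ≡ 0
sum-zero {0}     t z = refl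
sum-zero {suc n} t z = cong₂ _+_ (z zero) (sum-zero (t ∘ suc) (z ∘ suc))

sum-single : ∀ {n} (t : Fin n → ℕ) i → (∀ j → i ≢ j → t j ≡ 0) →
             sum t ≡ t i
sum-single t zero    z = trans (cong (t zero +_) (sum-zero (t ∘ suc) (λ j → z (suc j) λ ())))
                               (+-identityʳ (t zero))
sum-single t (suc i) z = cong₂ _+_ (z zero λ ()) (sum-single (t ∘ suc) i (λ j i≢j → z (suc j) λ { refl → i≢j refl }))

-- Double counting: each selected term is spread over Kronecker deltas indexed by `Fin k`, and the
-- two sums are exchanged. Injectivity of `x` leaves exactly one nonzero place for each selected
-- element. This turns the weight of a subgraph into a sum over three corners and three sides.
∑-image : ∀ {n k} {A : Set} (enum : Fin n ↔ A) (P : A → Bool) (f : A → ℕ) (x : Fin k → A) →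
          Injective _≡_ _≡_ x → (∀ i → T (P (x i))) → (∀ {a} → T (P a) → ∃ λ i → x i ≡ a) →
          ∑ enum (λ a → if P a then f a else 0) ≡ sum (f ∘ x)
∑-image {n} {k} enum P f x x-inj Px P⊆x = begin
  sum (λ j → if P (to j) then f (to j) else 0)  ≡⟨ sum-cong-≗ pointwise ⟩
  sum (λ j → sum (λ i → δ i j))                 ≡⟨ ∑-comm (λ j i → δ i j) ⟩
  sum (λ i → sum (λ j → δ i j))                 ≡⟨ sum-cong-≗ column ⟩
  sum (f ∘ x)                                   ∎
  where
  open ≡-Reasoning
  open Inverse enum using (to; from; strictlyInverseˡ; strictlyInverseʳ)

  δ : Fin k → Fin n → ℕ
  δ i j = if does (from (x i) ≟ j) then f (to j) else 0

  δ-≡ : ∀ {i j} → from (x i) ≡ j → δ i j ≡ f (to j)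
  δ-≡ {i} {j} p with from (x i) ≟ j
  ... | yes _ = refl
  ... | no ¬p = contradiction p ¬p

  δ-≢ : ∀ {i j} → from (x i) ≢ j → δ i j ≡ 0
  δ-≢ {i} {j} ¬p with from (x i) ≟ j
  ... | yes p = contradiction p ¬p
  ... | no _  = refl

  column : ∀ i → sum (δ i) ≡ f (x i)
  column i = trans (sum-single (δ i) (from (x i)) (λ _ → δ-≢ {i}))
                   (trans (δ-≡ {i} refl) (cong f (strictlyInverseˡ (x i))))

  pointwise : ∀ j → (if P (to j) then f (to j) else 0) ≡ sum (λ i → δ i j)
  pointwise j with P (to j) in Pj
  ... | false = sym (sum-zero (λ i → δ i j) λ i → δ-≢ {i} λ { refl →
                  subst T Pj (subst (T ∘ P) (sym (strictlyInverseˡ (x i))) (Px i)) })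
  ... | true with i , xi≡ ← P⊆x (subst T (sym Pj) _) =
    sym (trans (sum-single (λ i → δ i j) i λ i′ i≢i′ → δ-≢ {i′} λ p → i≢i′ (x-inj (trans xi≡ (trans (cong to (sym p)) (strictlyInverseˡ (x i′))))))
               (δ-≡ {i} (trans (cong from xi≡) (strictlyInverseʳ j))))

-- Pigeonhole: if `j` were missed, `punchOut` would give an injection of `suc n` elements into `n`
-- values.
injective⇒onto : ∀ {n} {A : Set} → Fin n ↔ A → (f : A → ℕ) → Injective _≡_ _≡_ f →
                 (∀ a → f a < n) → ∀ {j} → j < n → ∃ λ a → f a ≡ j
injective⇒onto {suc n} {A} enum f f-inj f<n {j} j<n with any? (λ i → fromℕ< (f<n (Inverse.to enum i)) ≟ fromℕ< j<n)
... | yes (i , p) = Inverse.to enum i , fromℕ<-injective _ _ (f<n _) j<n p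
... | no ¬p = ⊥-elim (<⇒notInjective {f = λ i → punchOut (missed i)} (n<1+n n) λ {i} {i′} p →
    Injection.injective (↔⇒↣ enum)
      (f-inj (fromℕ<-injective _ _ (f<n _) (f<n _) (punchOut-injective (missed i) (missed i′) p))))
  where
  missed : ∀ i → fromℕ< j<n ≢ fromℕ< (f<n (Inverse.to enum i))
  missed i q = ¬p (i , sym q)

-- Labels counted from 0. Once `A` is known to have `n` elements, surjectivity onto the numbers
-- below `n` follows by counting.
record Numbering (A : Set) (n : ℕ) : Set where
  field
    number    : A → ℕ
    bounded   : ∀ a → number a < n
    injective : Injective _≡_ _≡_ number

open Numbering

infixr 1 _⊕_

_⊕_ : ∀ {A B m n} → Numbering A m → Numbering B n → Numbering (A ⊎ B) (m + n)
_⊕_ {A} {B} {m} {n} α β = record { number = num ; bounded = bnd ; injective = inj }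
  where
  num : A ⊎ B → ℕ
  num = [ number α , (m +_) ∘ number β ]′

  bnd : ∀ x → num x < m + n
  bnd (inj₁ a) = ≤-trans (bounded α a) (m≤m+n m n)
  bnd (inj₂ b) = +-monoʳ-< m (bounded β b)

  apart : ∀ a b → number α a ≢ m + number β b
  apart a b p = <⇒≱ (bounded α a) (subst (m ≤_) (sym p) (m≤m+n m _))

  inj : Injective _≡_ _≡_ num
  inj {inj₁ _} {inj₁ _} p = cong inj₁ (injective α p)
  inj {inj₁ a} {inj₂ b} p = ⊥-elim (apart a b p)
  inj {inj₂ b} {inj₁ a} p = ⊥-elim (apart a b (sym p))
  inj {inj₂ _} {inj₂ _} p = cong inj₂ (injective β (+-cancelˡ-≡ m _ _ p))

numbering⇒onto : ∀ {A n} → Fin n ↔ A → (α : Numbering A n) → ∀ {j} → j < n → ∃ λ a → number α a ≡ j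
numbering⇒onto enum α = injective⇒onto enum (number α) (injective α) (bounded α)

module _ (G : FiniteGraph) (α : Numbering (FiniteGraph.V G) (FiniteGraph.order G))
         (β : Numbering (FiniteGraph.E G) (FiniteGraph.size G)) where
  open FiniteGraph G

  labeling : Labeling G
  labeling = mk⤖ {to = λ x → fromℕ< (bounded (α ⊕ β) x)}
    ( (λ p → injective (α ⊕ β) (fromℕ<-injective _ _ _ _ p))
    , λ y → let x , p = numbering⇒onto (↔-trans +↔⊎ (vertices ⊎-↔ edges)) (α ⊕ β) (toℕ<n y) in
        x , λ { refl → toℕ-injective (trans (toℕ-fromℕ< (bounded (α ⊕ β) x)) p) })

  label-labeling : ∀ x → label G labeling x ≡ suc (number (α ⊕ β) x)
  label-labeling x = cong suc (toℕ-fromℕ< (bounded (α ⊕ β) x))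

  labeling-verticesFirst : VerticesFirst G labeling
  labeling-verticesFirst k = mk⇔
    (λ { (v , refl) → s≤s z≤n , subst (_≤ order) (sym (label-labeling (inj₁ v))) (bounded α v) })
    (back k)
    where
    back : ∀ k → 1 ≤ k × k ≤ order → ∃ λ v → label G labeling (inj₁ v) ≡ k
    back (suc j) (_ , j<o) with v , p ← numbering⇒onto vertices α j<o =
      v , trans (label-labeling (inj₁ v)) (cong suc p)

-- Triangles and copies of C₃

C₃ : FiniteGraph
C₃ = C 3 ≤-refl

module C₃ = FiniteGraph C₃

C₃-adjacent : (i j : Fin 3) → i ≡ j ⊎ next i ≡ j ⊎ next j ≡ i
C₃-adjacent 0F 0F = inj₁ refl
C₃-adjacent 0F 1F = inj₂ (inj₁ refl)
C₃-adjacent 0F 2F = inj₂ (inj₂ refl)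
C₃-adjacent 1F 0F = inj₂ (inj₂ refl)
C₃-adjacent 1F 1F = inj₁ refl
C₃-adjacent 1F 2F = inj₂ (inj₁ refl)
C₃-adjacent 2F 0F = inj₂ (inj₁ refl)
C₃-adjacent 2F 1F = inj₂ (inj₂ refl)
C₃-adjacent 2F 2F = inj₁ refl

module _ {G : Graph} where
  open Graph G

  Joins-sym : ∀ {e u v} → Joins e u v → Joins e v u
  Joins-sym (inj₁ p) = inj₂ p
  Joins-sym (inj₂ p) = inj₁ p

  Joins-unique : ∀ {e u v u′ v′} → Joins e u v → Joins e u′ v′ →
                 (u ≡ u′ × v ≡ v′) ⊎ (u ≡ v′ × v ≡ u′)
  Joins-unique (inj₁ p) (inj₁ q) with refl ← trans (sym p) q = inj₁ (refl , refl)
  Joins-unique (inj₁ p) (inj₂ q) with refl ← trans (sym p) q = inj₂ (refl , refl)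
  Joins-unique (inj₂ p) (inj₁ q) with refl ← trans (sym p) q = inj₂ (refl , refl)
  Joins-unique (inj₂ p) (inj₂ q) with refl ← trans (sym p) q = inj₁ (refl , refl)

  module _ {S : Subgraph G} where
    private module S = Graph (asGraph S)

    Joins⁻ : ∀ {e u v} → S.Joins e u v → Joins (proj₁ e) (proj₁ u) (proj₁ v)
    Joins⁻ (inj₁ p) = inj₁ (cong (map proj₁ proj₁) p)
    Joins⁻ (inj₂ p) = inj₂ (cong (map proj₁ proj₁) p)

    Joins⁺ : ∀ {e u v} → Joins (proj₁ e) (proj₁ u) (proj₁ v) → S.Joins e u v
    Joins⁺ (inj₁ p) = inj₁ (cong₂ _,_ (Σ-T-≡ (cong proj₁ p)) (Σ-T-≡ (cong proj₂ p)))
    Joins⁺ (inj₂ p) = inj₂ (cong₂ _,_ (Σ-T-≡ (cong proj₁ p)) (Σ-T-≡ (cong proj₂ p)))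

-- The starting corner and the direction are part of the data, so one copy of `C₃` comes from six
-- triangles.
record Triangle (G : Graph) : Set where
  open Graph G
  field
    corner : Fin 3 → V
    side   : Fin 3 → E
    joins  : ∀ i → Joins (side i) (corner i) (corner (next i))

  -- Distinct indices are consecutive in one direction or the other, so equal corners would turn a
  -- side into a loop.
  corner-injective : Injective _≡_ _≡_ corner
  corner-injective {i} {j} p with C₃-adjacent i j
  ... | inj₁ i≡j = i≡j
  ... | inj₂ (inj₁ refl) = ⊥-elim (loopless (subst (Joins _ _) (sym p) (joins i)))
  ... | inj₂ (inj₂ refl) = ⊥-elim (loopless (subst (Joins _ _) p (joins j)))

  -- The ends of a repeated side match either straight, giving equal corners, or crosswise, which
  -- would bring `next` back to `j` after two steps.
  side-injective : Injective _≡_ _≡_ side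
  side-injective {i} {j} p
    with Joins-unique {G} (joins i) (subst (λ e → Joins e (corner j) (corner (next j))) (sym p) (joins j))
  ... | inj₁ (q , _) = corner-injective q
  ... | inj₂ (q , r) = ⊥-elim (next²-≢ ≤-refl j
                        (trans (cong next (sym (corner-injective q))) (corner-injective r)))

rotate : {G : Graph} → Triangle G → Triangle G
rotate Δ = record { corner = corner ∘ next ; side = side ∘ next ; joins = joins ∘ next }
  where open Triangle Δ

record _SpannedBy_ {G : Graph} (S : Subgraph G) (Δ : Triangle G) : Set where
  open Graph G
  open Subgraph S
  open Triangle Δ
  field
    corner∈ : ∀ i → T (inV (corner i))
    side∈   : ∀ i → T (inE (side i))
    ∈corner : ∀ {v} → T (inV v) → ∃ λ i → corner i ≡ v
    ∈side   : ∀ {e} → T (inE e) → ∃ λ i → side i ≡ e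

-- An isomorphism records vertices and adjacency only, so the sides are chosen as witnesses of
-- adjacency in the subgraph. Simplicity then identifies every edge of the subgraph with one of the
-- three.
≅C₃⇒SpannedBy : {G : Graph} {S : Subgraph G} → asGraph S ≅ C₃.graph → ∃ λ Δ → S SpannedBy Δ
≅C₃⇒SpannedBy {G} {S} iso = Δ , record
  { corner∈ = λ i → proj₂ (from i)
  ; side∈   = λ i → proj₂ (proj₁ (edge i))
  ; ∈corner = λ {v} p → to (v , p) , cong proj₁ (strictlyInverseʳ (v , p))
  ; ∈side   = λ {e} p → ∈side (e , p)
  }
  where
  open Graph G
  open Subgraph S
  open _≅_ iso
  open Inverse bijection using (to; from; strictlyInverseˡ; strictlyInverseʳ)
  module S = Graph (asGraph S)

  edge : ∀ i → S.Adjacent (from i) (from (next i))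
  edge i = Equivalence.from (adjacency _ _)
    (i , inj₁ (sym (cong₂ _,_ (strictlyInverseˡ i) (strictlyInverseˡ (next i)))))

  Δ : Triangle G
  Δ = record
    { corner = proj₁ ∘ from
    ; side   = proj₁ ∘ proj₁ ∘ edge
    ; joins  = Joins⁻ {S = S} ∘ proj₂ ∘ edge
    }

  simple-edge : ∀ i {e u v} → S.Joins e u v → (i , next i) ≡ (to u , to v) → proj₁ (edge i) ≡ e
  simple-edge i {u = u} {v} j p = S.simple (proj₂ (edge i))
    (subst₂ (S.Joins _) (trans (sym (strictlyInverseʳ u)) (cong from (sym (cong proj₁ p))))
                        (trans (sym (strictlyInverseʳ v)) (cong from (sym (cong proj₂ p)))) j)

  ∈side : ∀ e → ∃ λ i → proj₁ (proj₁ (edge i)) ≡ proj₁ e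
  ∈side e with Equivalence.to (adjacency _ _) (e , inj₁ refl)
  ... | i , inj₁ p = i , cong proj₁ (simple-edge i (inj₁ refl) p)
  ... | i , inj₂ p = i , cong proj₁ (simple-edge i (inj₂ refl) p)

SpannedBy⇒≅C₃ : {G : Graph} {S : Subgraph G} {Δ : Triangle G} → S SpannedBy Δ → asGraph S ≅ C₃.graph
SpannedBy⇒≅C₃ {G} {S} {Δ} span = record
  { bijection = mk↔ₛ′ to from
      (λ i → to≡ refl)
      (λ (v , p) → Σ-T-≡ (proj₂ (∈corner p)))
  ; adjacency = λ u v → mk⇔ (λ (e , j) → forth e j) back
  }
  where
  open Graph G
  open Subgraph S
  open Triangle Δ
  open _SpannedBy_ span
  module S = Graph (asGraph S)

  to : S.V → Fin 3
  to (_ , p) = proj₁ (∈corner p)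

  from : Fin 3 → S.V
  from i = corner i , corner∈ i

  to≡ : ∀ {u i} → proj₁ u ≡ corner i → to u ≡ i
  to≡ {_ , p} q = corner-injective (trans (proj₂ (∈corner p)) q)

  corner-to : ∀ u → corner (to u) ≡ proj₁ u
  corner-to (_ , p) = proj₂ (∈corner p)

  forth : ∀ {u v} e → S.Joins e u v → C₃.Adjacent (to u) (to v)
  forth {u} {v} (e , p) j with i , refl ← ∈side p with Joins-unique {G} (Joins⁻ {S = S} j) (joins i)
  ... | inj₁ (q , r) = i , inj₁ (sym (cong₂ _,_ (to≡ {u} q) (to≡ {v} r)))
  ... | inj₂ (q , r) = i , inj₂ (sym (cong₂ _,_ (to≡ {v} r) (to≡ {u} q)))

  via : ∀ {u v} i → (i , next i) ≡ (to u , to v) → S.Joins (side i , side∈ i) u v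
  via {u} {v} i p = Joins⁺ {S = S} (subst₂ (Joins (side i))
    (trans (cong (corner ∘ proj₁) p) (corner-to u)) (trans (cong (corner ∘ proj₂) p) (corner-to v)) (joins i))

  back : ∀ {u v} → C₃.Adjacent (to u) (to v) → S.Adjacent u v
  back {u} {v} (i , inj₁ p) = _ , via {u} {v} i p
  back {u} {v} (i , inj₂ p) = _ , Joins-sym {asGraph S} {(side i , side∈ i)} {v} {u} (via {v} {u} i p)

module _ {G : Graph} (_≟V_ : DecidableEquality (Graph.V G)) (_≟E_ : DecidableEquality (Graph.E G))
         (Δ : Triangle G) where
  open Graph G
  open Triangle Δ

  private
    corner? : ∀ v → Dec (∃ λ i → corner i ≡ v)
    corner? v = any? (λ i → corner i ≟V v)

    side? : ∀ e → Dec (∃ λ i → side i ≡ e)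
    side? e = any? (λ i → side i ≟E e)

    end∈ : ∀ i → (∃ λ j → corner j ≡ proj₁ (ends (side i))) × (∃ λ j → corner j ≡ proj₂ (ends (side i)))
    end∈ i with joins i
    ... | inj₁ p = (i , sym (cong proj₁ p)) , (next i , sym (cong proj₂ p))
    ... | inj₂ p = (next i , sym (cong proj₁ p)) , (i , sym (cong proj₂ p))

  subgraph : Subgraph G
  subgraph = record
    { inV    = λ v → ⌊ corner? v ⌋
    ; inE    = λ e → ⌊ side? e ⌋
    ; closed = λ e p → closed e (toWitness {a? = side? e} p)
    }
    where
    closed : ∀ e → (∃ λ i → side i ≡ e) →
             T ⌊ corner? (proj₁ (ends e)) ⌋ × T ⌊ corner? (proj₂ (ends e)) ⌋
    closed _ (i , refl) = map fromWitness fromWitness (end∈ i)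

  subgraph-SpannedBy : subgraph SpannedBy Δ
  subgraph-SpannedBy = record
    { corner∈ = λ i → fromWitness (i , refl)
    ; side∈   = λ i → fromWitness (i , refl)
    ; ∈corner = λ {v} → toWitness {a? = corner? v}
    ; ∈side   = λ {e} → toWitness {a? = side? e}
    }

-- Each of the six labels is one more than its number, and the three edge labels are moved past the
-- `o` vertices.
shift-six : ∀ o a b c x y z →
  (suc a + (suc b + (suc c + 0))) + (suc (o + x) + (suc (o + y) + (suc (o + z) + 0))) ≡
  6 + 3 * o + ((a + (b + (c + 0))) + (x + (y + (z + 0))))
shift-six = solve-∀

module _ (G : FiniteGraph) where
  open FiniteGraph G

  triangles-cover : DecidableEquality V → DecidableEquality E →
                    (∀ e → ∃ λ (Δ : Triangle graph) → ∃ λ i → Triangle.side Δ i ≡ e) →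
                    HasCovering C₃ G
  triangles-cover _≟V_ _≟E_ triangle e with Δ , i , refl ← triangle e =
    subgraph _≟V_ _≟E_ Δ , _SpannedBy_.side∈ span i , SpannedBy⇒≅C₃ span
    where span = subgraph-SpannedBy _≟V_ _≟E_ Δ

  triangleSum : (V → ℕ) → (E → ℕ) → Triangle graph → ℕ
  triangleSum f g Δ = sum (f ∘ corner) + sum (g ∘ side)
    where open Triangle Δ

  weight-SpannedBy : ∀ ℓ {S Δ} → S SpannedBy Δ →
                     weight G ℓ S ≡ triangleSum (label G ℓ ∘ inj₁) (label G ℓ ∘ inj₂) Δ
  weight-SpannedBy ℓ {S} {Δ} span = cong₂ _+_
    (∑-image vertices inV (label G ℓ ∘ inj₁) corner corner-injective corner∈ ∈corner)
    (∑-image edges    inE (label G ℓ ∘ inj₂) side   side-injective   side∈   ∈side)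
    where
    open Subgraph S
    open Triangle Δ
    open _SpannedBy_ span

  -- Reduces the problem to numberings from 0 with constant sum over triangles: passing to labels
  -- adds the same amount to every triangle.
  triangles⇒supermagic : DecidableEquality V → DecidableEquality E →
    (∀ e → ∃ λ (Δ : Triangle graph) → ∃ λ i → Triangle.side Δ i ≡ e) →
    (onV : Numbering V order) (onE : Numbering E size) (c : ℕ) →
    (∀ Δ → triangleSum (Numbering.number onV) (Numbering.number onE) Δ ≡ c) →
    IsSupermagic C₃ G
  triangles⇒supermagic _≟V_ _≟E_ cover onV onE c magic =
    triangles-cover _≟V_ _≟E_ cover ,
    ℓ , (6 + 3 * order + c , magical) , labeling-verticesFirst G onV onE
    where
    open Numbering

    ℓ : Labeling G
    ℓ = labeling G onV onE

    magical : ∀ S → asGraph S ≅ C₃.graph → weight G ℓ S ≡ 6 + 3 * order + c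
    magical S iso with Δ , span ← ≅C₃⇒SpannedBy iso = begin
      weight G ℓ S
        ≡⟨ weight-SpannedBy ℓ span ⟩
      triangleSum (label G ℓ ∘ inj₁) (label G ℓ ∘ inj₂) Δ
        ≡⟨ cong₂ _+_ (sum-cong-≗ (label-labeling G onV onE ∘ inj₁ ∘ corner))
                     (sum-cong-≗ (label-labeling G onV onE ∘ inj₂ ∘ side)) ⟩
      triangleSum (suc ∘ number onV) (λ e → suc (order + number onE e)) Δ
        ≡⟨ shift-six order (number onV (corner 0F)) _ _ (number onE (side 0F)) _ _ ⟩
      6 + 3 * order + triangleSum (number onV) (number onE) Δ
        ≡⟨ cong (6 + 3 * order +_) (magic Δ) ⟩
      6 + 3 * order + c ∎
      where
      open ≡-Reasoning
      open Triangle Δ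

-- Triangles of wheels

next-cases : ∀ {n} (i : Fin n) → (suc (toℕ i) < n × toℕ (next i) ≡ suc (toℕ i))
                               ⊎ (suc (toℕ i) ≡ n × toℕ (next i) ≡ 0)
next-cases {suc n} i with m≤n⇒m<n∨m≡n (toℕ<n i)
... | inj₁ i<n = inj₁ (i<n , trans (toℕ-next i) (m<n⇒m%n≡m i<n))
... | inj₂ i≡n = inj₂ (i≡n , trans (toℕ-next i) (trans (cong (_% suc n) i≡n) (n%n≡0 (suc n))))

next-injective : ∀ {n} → Injective _≡_ _≡_ (next {n})
next-injective {n} {i} {j} p with next-cases i | next-cases j
... | inj₁ (_ , q) | inj₁ (_ , r) = toℕ-injective (suc-injective (trans (sym q) (trans (cong toℕ p) r)))
... | inj₁ (_ , q) | inj₂ (_ , r) with () ← trans (sym q) (trans (cong toℕ p) r)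
... | inj₂ (_ , q) | inj₁ (_ , r) with () ← trans (sym q) (trans (cong toℕ p) r)
... | inj₂ (q , _) | inj₂ (r , _) = toℕ-injective (suc-injective (trans q (sym r)))

-- Without a wrap the index would grow by 3, and two wraps would force `n` to be 1 or 2. Exactly one
-- wrap means that 3 - n is zero. Hence a rim contains a triangle only in `W₃`.
next³-fixed : ∀ {n} → 3 ≤ n → (i : Fin n) → next (next (next i)) ≡ i → n ≡ 3
next³-fixed 3≤n i p with next-cases i | next-cases (next i) | next-cases (next (next i))
... | inj₁ (_ , a) | inj₁ (_ , b) | inj₁ (_ , c) =
  ⊥-elim (m+1+n≢n 2 (trans (sym (trans c (cong suc (trans b (cong suc a))))) (cong toℕ p)))
... | inj₁ (_ , a) | inj₁ (_ , b) | inj₂ (c , d) =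
  trans (sym c) (cong suc (trans b (cong suc (trans a (cong suc (trans (sym (cong toℕ p)) d))))))
... | inj₁ (_ , a) | inj₂ (b , c) | inj₁ (_ , d) =
  trans (sym b) (cong suc (trans a (cong suc (trans (sym (cong toℕ p)) (trans d (cong suc c))))))
... | inj₂ (a , b) | inj₁ (_ , c) | inj₁ (_ , d) =
  trans (sym a) (cong suc (trans (sym (cong toℕ p)) (trans d (cong suc (trans c (cong suc b))))))
... | inj₂ (_ , b) | inj₂ (c , _) | _ = ⊥-elim (<⇒≢ (≤-trans (s≤s (s≤s z≤n)) 3≤n) (trans (cong suc (sym b)) c))
... | inj₁ _ | inj₂ (_ , b) | inj₂ (c , _) = ⊥-elim (<⇒≢ (≤-trans (s≤s (s≤s z≤n)) 3≤n) (trans (cong suc (sym b)) c))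
... | inj₂ (_ , a) | inj₁ (_ , b) | inj₂ (c , _) =
  ⊥-elim (<⇒≢ 3≤n (trans (cong suc (sym (trans b (cong suc a)))) c))

module _ {G : Graph} where
  open Graph G

  -- With `rotate`, this reaches all six ways of running around one triangle.
  reflect : Triangle G → Triangle G
  reflect Δ = record
    { corner = λ { 0F → corner 0F ; 1F → corner 2F ; 2F → corner 1F }
    ; side   = λ { 0F → side 2F ; 1F → side 1F ; 2F → side 0F }
    ; joins  = λ { 0F → Joins-sym {G} (joins 2F) ; 1F → Joins-sym {G} (joins 1F) ; 2F → Joins-sym {G} (joins 0F) }
    }
    where open Triangle Δ

rotate-sum : ∀ a b c x y z →
  (a + (b + (c + 0))) + (x + (y + (z + 0))) ≡ (b + (c + (a + 0))) + (y + (z + (x + 0)))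
rotate-sum = solve-∀

reflect-sum : ∀ a b c x y z →
  (a + (b + (c + 0))) + (x + (y + (z + 0))) ≡ (a + (c + (b + 0))) + (z + (y + (x + 0)))
reflect-sum = solve-∀

module _ (G : FiniteGraph) (f : FiniteGraph.V G → ℕ) (g : FiniteGraph.E G → ℕ) where
  open FiniteGraph G

  triangleSum-rotate : ∀ Δ → triangleSum G f g Δ ≡ triangleSum G f g (rotate Δ)
  triangleSum-rotate Δ = rotate-sum (f (corner 0F)) (f (corner 1F)) (f (corner 2F)) (g (side 0F)) (g (side 1F)) (g (side 2F))
    where open Triangle Δ

  triangleSum-reflect : ∀ Δ → triangleSum G f g Δ ≡ triangleSum G f g (reflect Δ)
  triangleSum-reflect Δ = reflect-sum (f (corner 0F)) (f (corner 1F)) (f (corner 2F)) (g (side 0F)) (g (side 1F)) (g (side 2F))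
    where open Triangle Δ

  -- In a simple graph the corners determine the sides.
  triangleSum-cong : ∀ Δ Δ′ → (∀ i → Triangle.corner Δ i ≡ Triangle.corner Δ′ i) →
                     triangleSum G f g Δ ≡ triangleSum G f g Δ′
  triangleSum-cong Δ Δ′ p = cong₂ _+_ (sum-cong-≗ (cong f ∘ p))
    (sum-cong-≗ λ i → cong g (simple (Triangle.joins Δ i)
      (subst₂ (Joins _) (sym (p i)) (sym (p (next i))) (Triangle.joins Δ′ i))))

module _ {m n : ℕ} where

  hub : Fin m → Fin m × (⊤ ⊎ Fin n)
  hub k = k , inj₁ tt

  rim : Fin m → Fin n → Fin m × (⊤ ⊎ Fin n)
  rim k i = k , inj₂ i

  rim-injective : ∀ {k i j} → rim k i ≡ rim k j → i ≡ j
  rim-injective refl = refl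

  spoke arc : Fin m → Fin n → Fin m × (Fin n ⊎ Fin n)
  spoke k i = k , inj₁ i
  arc   k i = k , inj₂ i

  _≟V_ : DecidableEquality (Fin m × (⊤ ⊎ Fin n))
  _≟V_ = Product.≡-dec _≟_ (Sum.≡-dec Unit._≟_ _≟_)

  _≟E_ : DecidableEquality (Fin m × (Fin n ⊎ Fin n))
  _≟E_ = Product.≡-dec _≟_ (Sum.≡-dec _≟_ _≟_)

module _ {m n : ℕ} {3≤n : 3 ≤ n} where

  private
    mW : FiniteGraph
    mW = m · W n 3≤n

  open FiniteGraph mW

  fan : Fin m → Fin n → Triangle graph
  fan k i = record
    { corner = λ { 0F → hub k ; 1F → rim k i ; 2F → rim k (next i) }
    ; side   = λ { 0F → spoke k i ; 1F → arc k i ; 2F → spoke k (next i) }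
    ; joins  = λ { 0F → inj₁ refl ; 1F → inj₁ refl ; 2F → inj₂ refl }
    }

  -- The equation closes the walk along the rim. Keeping it as a hypothesis lets the classification
  -- below cover all `n` at once.
  rimTriangle : Fin m → (i : Fin n) → next (next (next i)) ≡ i → Triangle graph
  rimTriangle k i p = record
    { corner = λ { 0F → rim k i ; 1F → rim k (next i) ; 2F → rim k (next (next i)) }
    ; side   = λ { 0F → arc k i ; 1F → arc k (next i) ; 2F → arc k (next (next i)) }
    ; joins  = λ { 0F → inj₁ refl ; 1F → inj₁ refl ; 2F → inj₁ (cong (λ j → rim k (next (next i)) , rim k j) p) }
    }

  fans-cover : ∀ e → ∃ λ (Δ : Triangle graph) → ∃ λ i → Triangle.side Δ i ≡ e
  fans-cover (k , inj₁ i) = fan k i , 0F , refl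
  fans-cover (k , inj₂ i) = fan k i , 1F , refl

  infix 4 _⟶_

  -- Orients spokes outward and arcs forward. No arrow enters a hub, and exactly one leaves each rim
  -- vertex.
  data _⟶_ : V → V → Set where
    hub⟶rim : ∀ k i → hub k ⟶ rim k i
    rim⟶rim : ∀ k i → rim k i ⟶ rim k (next i)

  private
    ends-⟶ : ∀ e → proj₁ (ends e) ⟶ proj₂ (ends e)
    ends-⟶ (k , inj₁ i) = hub⟶rim k i
    ends-⟶ (k , inj₂ i) = rim⟶rim k i

  Joins⇒⟶ : ∀ e {u v} → Joins e u v → u ⟶ v ⊎ v ⟶ u
  Joins⇒⟶ e (inj₁ p) = inj₁ (subst₂ _⟶_ (cong proj₁ p) (cong proj₂ p) (ends-⟶ e))
  Joins⇒⟶ e (inj₂ p) = inj₂ (subst₂ _⟶_ (cong proj₁ p) (cong proj₂ p) (ends-⟶ e))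

  after-rim : ∀ {k i w} → rim k i ⟶ w → w ≡ rim k (next i)
  after-rim (rim⟶rim _ _) = refl

  -- Arrows to two different vertices leave `u`, which only a hub allows.
  transitive-fan : ∀ {u v w} → u ⟶ v → v ⟶ w → u ⟶ w →
                   ∃₂ λ k i → u ≡ hub k × v ≡ rim k i × w ≡ rim k (next i)
  transitive-fan (hub⟶rim k i) q _ = k , i , refl , refl , after-rim q
  transitive-fan (rim⟶rim k i) q r = ⊥-elim (next-≢ (<⇒≤ 3≤n) (next i)
    (rim-injective (trans (sym (after-rim q)) (after-rim r))))

  cyclic-rim : ∀ {u v w} → u ⟶ v → v ⟶ w → w ⟶ u →
               ∃₂ λ k i → u ≡ rim k i × v ≡ rim k (next i) × w ≡ rim k (next (next i)) ×
                          next (next (next i)) ≡ i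
  cyclic-rim (hub⟶rim _ _) _ ()
  cyclic-rim (rim⟶rim k i) q r with refl ← after-rim q =
    k , i , refl , refl , refl , sym (rim-injective (after-rim r))

  -- The sides of a triangle can be oriented in eight patterns. Two are cyclic and lie on a rim; six
  -- are transitive and give fans. Rotations and reflections bring each pattern to one of two
  -- standard forms without changing the sum.
  wheel-triangles : (f : V → ℕ) (g : E → ℕ) (c : ℕ) →
    (∀ k i → triangleSum mW f g (fan k i) ≡ c) →
    (∀ k i p → triangleSum mW f g (rimTriangle k i p) ≡ c) →
    ∀ Δ → triangleSum mW f g Δ ≡ c
  wheel-triangles f g c fan≡c rim≡c = every
    where
    transitive : ∀ Δ → let open Triangle Δ in corner 0F ⟶ corner 1F → corner 1F ⟶ corner 2F →
                 corner 0F ⟶ corner 2F → triangleSum mW f g Δ ≡ c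
    transitive Δ p q r with k , i , u≡ , v≡ , w≡ ← transitive-fan p q r =
      trans (triangleSum-cong mW f g Δ (fan k i) λ { 0F → u≡ ; 1F → v≡ ; 2F → w≡ }) (fan≡c k i)

    cyclic : ∀ Δ → let open Triangle Δ in corner 0F ⟶ corner 1F → corner 1F ⟶ corner 2F →
             corner 2F ⟶ corner 0F → triangleSum mW f g Δ ≡ c
    cyclic Δ p q r with k , i , u≡ , v≡ , w≡ , fixed ← cyclic-rim p q r =
      trans (triangleSum-cong mW f g Δ (rimTriangle k i fixed) λ { 0F → u≡ ; 1F → v≡ ; 2F → w≡ }) (rim≡c k i fixed)

    rotated : ∀ Δ → triangleSum mW f g (rotate Δ) ≡ c → triangleSum mW f g Δ ≡ c
    rotated Δ = trans (triangleSum-rotate mW f g Δ)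

    reflected : ∀ Δ → triangleSum mW f g (reflect Δ) ≡ c → triangleSum mW f g Δ ≡ c
    reflected Δ = trans (triangleSum-reflect mW f g Δ)

    every : ∀ Δ → triangleSum mW f g Δ ≡ c
    every Δ with Joins⇒⟶ (side 0F) (joins 0F) | Joins⇒⟶ (side 1F) (joins 1F) | Joins⇒⟶ (side 2F) (joins 2F)
      where open Triangle Δ
    ... | inj₁ p | inj₁ q | inj₁ r = cyclic Δ p q r
    ... | inj₁ p | inj₁ q | inj₂ r = transitive Δ p q r
    ... | inj₁ p | inj₂ q | inj₁ r = rotated Δ (rotated (rotate Δ) (transitive (rotate (rotate Δ)) r p q))
    ... | inj₁ p | inj₂ q | inj₂ r = reflected Δ (transitive (reflect Δ) r q p)
    ... | inj₂ p | inj₁ q | inj₁ r = rotated Δ (transitive (rotate Δ) q r p)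
    ... | inj₂ p | inj₁ q | inj₂ r = reflected Δ (rotated (reflect Δ) (rotated (rotate (reflect Δ)) (transitive (rotate (rotate (reflect Δ))) p r q)))
    ... | inj₂ p | inj₂ q | inj₁ r = reflected Δ (rotated (reflect Δ) (transitive (rotate (reflect Δ)) q p r))
    ... | inj₂ p | inj₂ q | inj₂ r = reflected Δ (cyclic (reflect Δ) r q p)

-- Numberings in mixed radix

singleton : Numbering ⊤ 1
singleton = record { number = λ _ → 0 ; bounded = λ _ → s≤s z≤n ; injective = λ _ → refl }

standard : ∀ {n} → Numbering (Fin n) n
standard = record { number = toℕ ; bounded = toℕ<n ; injective = toℕ-injective }

renumber : ∀ {A n} (h : ℕ → ℕ) → (∀ {x} → x < n → h x < n) →
           (∀ {x y} → x < n → y < n → h x ≡ h y → x ≡ y) → Numbering A n → Numbering A n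
renumber h h< h-inj α = record
  { number    = h ∘ number α
  ; bounded   = h< ∘ bounded α
  ; injective = injective α ∘ h-inj (bounded α _) (bounded α _)
  }

n∸1+m<n : ∀ {m n} → m < n → n ∸ suc m < n
n∸1+m<n {m} {suc n} _ = s≤s (m∸n≤m n m)

reverse : ∀ {A n} → Numbering A n → Numbering A n
reverse {n = n} = renumber (λ x → n ∸ suc x) n∸1+m<n (λ x<n y<n p → suc-injective (∸-cancelˡ-≡ x<n y<n p))

-- A smaller leading digit loses at least `m`, more than the units digit can restore.
digits-injective : ∀ {m a b k l} → k < m → l < m → m * a + k ≡ m * b + l → a ≡ b × k ≡ l
digits-injective {m} {a} {b} {k} {l} k<m l<m p = a≡b , +-cancelˡ-≡ (m * b) k l (subst (λ a → m * a + k ≡ m * b + l) a≡b p)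
  where
  a≮b : ∀ {a b k l} → k < m → m * a + k ≡ m * b + l → ¬ a < b
  a≮b {a} {b} {k} {l} k<m p a<b = <⇒≢ (begin-strict
    m * a + k <⟨ +-monoʳ-< (m * a) k<m ⟩
    m * a + m ≡⟨ trans (+-comm (m * a) m) (sym (*-suc m a)) ⟩
    m * suc a ≤⟨ *-monoʳ-≤ m a<b ⟩
    m * b     ≤⟨ m≤m+n (m * b) l ⟩
    m * b + l ∎) p
    where open ≤-Reasoning

  a≡b : a ≡ b
  a≡b = ≤-antisym (≮⇒≥ (a≮b l<m (sym p))) (≮⇒≥ (a≮b k<m p))

-- The copy gives the units digit in base `m`, so corresponding elements of the `m` copies share `m`
-- consecutive numbers.
layers : ∀ {A m n} → Numbering (Fin m) m → Numbering A n → Numbering (Fin m × A) (m * n)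
layers {m = m} {n} κ α = record
  { number    = λ (k , a) → m * number α a + number κ k
  ; bounded   = λ (k , a) → ≤-trans (+-monoʳ-< (m * number α a) (bounded κ k))
                  (subst (_≤ m * n) (trans (*-suc m _) (+-comm m _)) (*-monoʳ-≤ m (bounded α a)))
  ; injective = λ {(k , a)} {(l , b)} p →
      let p₁ , p₂ = digits-injective (bounded κ k) (bounded κ l) p in
      cong₂ _,_ (injective κ p₂) (injective α p₁)
  }

-- Odd wheels with more than three spokes

-- Equals x/2 + a for even x and (x - 1)/2 + b for odd x. The two base values adapt it to halving
-- modulo an odd number.
halve : ℕ → ℕ → ℕ → ℕ
halve a b 0             = a
halve a b 1             = b
halve a b (suc (suc x)) = suc (halve a b x)

halve-even : ∀ a b k → halve a b (k + k) ≡ k + a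
halve-even a b 0       = refl
halve-even a b (suc k) = trans (cong (halve a b ∘ suc) (+-suc k k)) (cong suc (halve-even a b k))

-- States that `h x` is (x - c)/2 modulo `n` for odd `n`. Allowing only 0 or `n` to be added also
-- gives 2 h(x) < 2n for x < n.
Halves : ℕ → ℕ → (ℕ → ℕ) → Set
Halves n c h = ∀ x → c + (h x + h x) ≡ x ⊎ c + (h x + h x) ≡ x + n

module _ {n : ℕ} (c : ℕ) (h : ℕ → ℕ) (halves : Halves n c h) where

  Halves⇒< : ∀ {x} → x < n → h x < n
  Halves⇒< {x} x<n = ≰⇒> λ n≤h → <⇒≱ (+-monoˡ-< n x<n) (≤-trans (+-mono-≤ n≤h n≤h) (doubled (halves x)))
    where
    doubled : c + (h x + h x) ≡ x ⊎ c + (h x + h x) ≡ x + n → h x + h x ≤ x + n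
    doubled (inj₁ p) = ≤-trans (m≤n+m (h x + h x) c) (≤-trans (≤-reflexive p) (m≤m+n x n))
    doubled (inj₂ p) = ≤-trans (m≤n+m (h x + h x) c) (≤-reflexive p)

  Halves⇒injective : ∀ {x y} → x < n → y < n → h x ≡ h y → x ≡ y
  Halves⇒injective {x} {y} x<n y<n p with halves x | halves y | cong (λ z → c + (z + z)) p
  ... | inj₁ q | inj₁ r | s = trans (sym q) (trans s r)
  -- In the mixed cases one of `x`, `y` exceeds the other by `n`, although both are below `n`.
  ... | inj₁ q | inj₂ r | s = ⊥-elim (<⇒≢ (<-≤-trans x<n (m≤n+m n y)) (trans (sym q) (trans s r)))
  ... | inj₂ q | inj₁ r | s = ⊥-elim (<⇒≢ (<-≤-trans y<n (m≤n+m n x)) (sym (trans (sym q) (trans s r))))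
  ... | inj₂ q | inj₂ r | s = +-cancelʳ-≡ n x y (trans (sym q) (trans s r))

  halved : ∀ {A} → Numbering A n → Numbering A n
  halved = renumber h Halves⇒< Halves⇒injective

halve-Halves : ∀ {n a b} c → c + (a + a) ≡ 0 ⊎ c + (a + a) ≡ n →
               c + (b + b) ≡ 1 ⊎ c + (b + b) ≡ 1 + n → Halves n c (halve a b)
halve-Halves c h₀ h₁ 0 = h₀
halve-Halves c h₀ h₁ 1 = h₁
halve-Halves {n} {a} {b} c h₀ h₁ (suc (suc x)) =
  [ inj₁ ∘ step , inj₂ ∘ step ]′ (halve-Halves {n} {a} {b} c h₀ h₁ x)
  where
  shift : ∀ c y → c + (suc y + suc y) ≡ 2 + (c + (y + y))
  shift = solve-∀

  step : ∀ {y z} → c + (y + y) ≡ z → c + (suc y + suc y) ≡ 2 + z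
  step {y} p = trans (shift c y) (cong (2 +_) p)

module OddWheels (m q : ℕ) {n : ℕ} (n≡ : n ≡ suc (q + q)) (3≤n : 3 ≤ n) where

  -- The base values are halves modulo `n`: 2(q + 1) = n + 1 makes `suc q` half of 1, and 1 + 2q = n
  -- makes `q` half of -1.
  f g : ℕ → ℕ
  f = halve 0 (suc q)
  g = halve q 0

  Halves-f : Halves n 0 f
  Halves-f = halve-Halves 0 (inj₁ refl) (inj₂ (trans (cong suc (+-suc q q)) (cong suc (sym n≡))))

  Halves-g : Halves n 1 g
  Halves-g = halve-Halves 1 (inj₂ (sym n≡)) (inj₁ refl)

  f+g : ∀ x → f x + g x ≡ q + x
  f+g 0 = sym (+-identityʳ q)
  f+g 1 = trans (+-identityʳ (suc q)) (sym (+-comm q 1))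
  f+g (suc (suc x)) = trans (cong suc (+-suc (f x) (g x)))
    (trans (cong (2 +_) (f+g x)) (sym (trans (+-suc q (suc x)) (cong suc (+-suc q x)))))

  f+f-suc : ∀ x → f x + f (suc x) ≡ q + suc x
  f+f-suc 0 = sym (+-comm q 1)
  f+f-suc (suc x) = trans (+-suc (f (suc x)) (f x))
    (trans (cong suc (trans (+-comm (f (suc x)) (f x)) (f+f-suc x))) (sym (+-suc q (suc x))))

  f+f-next : (i : Fin n) → f (toℕ i) + f (toℕ (next i)) ≡ q + toℕ (next i)
  f+f-next i with next-cases i
  ... | inj₁ (_ , p) = subst (λ j → f (toℕ i) + f j ≡ q + j) (sym p) (f+f-suc (toℕ i))
  -- At the wrap the last index is `q + q`, whose half is `q`, and the next index is 0.
  ... | inj₂ (p , r) = subst (λ j → f (toℕ i) + f j ≡ q + j) (sym r)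
    (cong (_+ 0) (trans (cong f (suc-injective (trans p n≡))) (trans (halve-even 0 (suc q) q) (+-identityʳ q))))

  private
    reverse-sum : ∀ {n} (x : Fin n) → toℕ x + (n ∸ suc (toℕ x)) ≡ n ∸ 1
    reverse-sum {suc n} x = m+[n∸m]≡n (≤-pred (toℕ<n x))

    -- A fan in base `m`: units digits `k` on vertices and `k′` on edges; leading digits `a`, `a′`
    -- from the rim, `b`, `b′` from the spokes and `r` from the arc.
    regroup₁ : ∀ m n k k′ a b a′ b′ r →
      (m * 0 + k + (m * (1 + a) + k + (m * (1 + a′) + k + 0))) +
      (m * b + k′ + (m * (n + r) + k′ + (m * b′ + k′ + 0))) ≡
      3 * (k + k′) + m * (2 + n + ((a + b) + (a′ + b′)) + r)
    regroup₁ = solve-∀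

    regroup₂ : ∀ q x y → (q + x) + (q + y) ≡ q + q + (x + y)
    regroup₂ = solve-∀

    regroup₃ : ∀ q n j r → 2 + n + (q + q + (q + j)) + r ≡ 2 + n + 3 * q + (j + r)
    regroup₃ = solve-∀

  half : Numbering (Fin n) n
  half = halved 0 f Halves-f standard

  -- The arc from i is numbered by i + 1, the term that `f+f-next` leaves to be cancelled.
  successor : Numbering (Fin n) n
  successor = record
    { number    = toℕ ∘ next
    ; bounded   = λ i → toℕ<n (next i)
    ; injective = next-injective ∘ toℕ-injective
    }

  onV : Numbering (Fin m × (⊤ ⊎ Fin n)) (m * (1 + n))
  onV = layers standard (singleton ⊕ halved 0 f Halves-f half)

  onE : Numbering (Fin m × (Fin n ⊎ Fin n)) (m * (n + n))
  onE = layers (reverse standard) (halved 1 g Halves-g half ⊕ reverse successor)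

  magicSum : ℕ
  magicSum = 3 * (m ∸ 1) + m * (2 + n + 3 * q + (n ∸ 1))

  -- Rim and spoke digits first add up to 2q + F + F′ by `f+g`, then to 3q + (i + 1) by `f+f-next`;
  -- the reversed digit of the arc completes i + 1 to n - 1.
  fan-magicSum : ∀ k i → triangleSum (m · W n 3≤n) (number onV) (number onE) (fan k i) ≡ magicSum
  fan-magicSum k i = trans
    (regroup₁ m n (toℕ k) (m ∸ suc (toℕ k)) (f F) (g F) (f F′) (g F′) (n ∸ suc (toℕ (next i))))
    (cong₂ (λ x y → 3 * x + m * y) (reverse-sum k) (trans
      (cong (λ x → 2 + n + x + (n ∸ suc (toℕ (next i)))) (trans (cong₂ _+_ (f+g F) (f+g F′))
        (trans (regroup₂ q F F′) (cong (q + q +_) (f+f-next i)))))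
      (trans (regroup₃ q n (toℕ (next i)) (n ∸ suc (toℕ (next i))))
        (cong (2 + n + 3 * q +_) (reverse-sum (next i))))))
    where
    F  = f (toℕ i)
    F′ = f (toℕ (next i))

  supermagic : n ≢ 3 → IsSupermagic C₃ (m · W n 3≤n)
  supermagic n≢3 = triangles⇒supermagic (m · W n 3≤n) _≟V_ _≟E_ fans-cover onV onE magicSum
    (wheel-triangles {3≤n = 3≤n} (number onV) (number onE) magicSum fan-magicSum
      (λ k i p → ⊥-elim (n≢3 (next³-fixed 3≤n i p))))

-- Blocks of consecutive labels

total : {A : Set} → (A → ℕ) → List A → ℕ
total s = sumₗ ∘ List.map s

combination : {A : Set} → (A → ℕ) → (A → ℕ) → ℕ → ℕ → A → ℕ
combination α β t u a = α a * t + β a * u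

private
  add-combinations : ∀ a b c d t u → (a * t + b * u) + (c * t + d * u) ≡ (a + c) * t + (b + d) * u
  add-combinations = solve-∀

module _ {A : Set} (α β : A → ℕ) (t u : ℕ) where

  total-combination : ∀ l → total (combination α β t u) l ≡ total α l * t + total β l * u
  total-combination []      = refl
  total-combination (a ∷ l) = trans (cong (combination α β t u a +_) (total-combination l))
    (add-combinations (α a) (β a) (total α l) (total β l) t u)

module _ {A : Set} (_≟A_ : DecidableEquality A) where

  -- Blocks of lengths s b are laid end to end in the order of l; junk value total s l
  -- if a does not occur in l.
  start : (A → ℕ) → List A → A → ℕ
  start s []      a = 0
  start s (b ∷ l) a = if does (b ≟A a) then 0 else s b + start s l a

  -- Positions are sums of block lengths, hence linear in `t` and `u`. A check of two coefficients
  -- thus settles all `t` and `u`.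
  start-combination : ∀ α β t u l a → start (combination α β t u) l a ≡ start α l a * t + start β l a * u
  start-combination α β t u []      a = refl
  start-combination α β t u (b ∷ l) a with b ≟A a
  ... | yes _ = refl
  ... | no  _ = trans (cong (combination α β t u b +_) (start-combination α β t u l a))
    (add-combinations (α b) (β b) (start α l a) (start β l a) t u)

  module _ (s : A → ℕ) where

    start-fits : ∀ {l a} → a ∈ l → start s l a + s a ≤ total s l
    start-fits {b ∷ l} {a} a∈ with b ≟A a
    ... | yes refl = m≤m+n (s b) (total s l)
    start-fits (here refl) | no b≢a = ⊥-elim (b≢a refl)
    start-fits {b ∷ l} {a} (there a∈) | no _ =
      subst (_≤ s b + total s l) (sym (+-assoc (s b) _ (s a))) (+-monoʳ-≤ (s b) (start-fits a∈))

    -- Blocks are disjoint: at the first of the two reached along the list, a later block starts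
    -- beyond its end.
    start-injective : ∀ {l a a′ x x′} → a ∈ l → a′ ∈ l → x < s a → x′ < s a′ →
                      start s l a + x ≡ start s l a′ + x′ → a ≡ a′ × x ≡ x′
    start-injective {b ∷ l} {a} {a′} a∈ a′∈ x< x′< p with b ≟A a | b ≟A a′
    ... | yes refl | yes refl = refl , p
    ... | yes refl | no _ =
      ⊥-elim (<⇒≢ (<-≤-trans x< (≤-trans (m≤m+n (s b) _) (m≤m+n _ _))) p)
    ... | no _ | yes refl =
      ⊥-elim (<⇒≢ (<-≤-trans x′< (≤-trans (m≤m+n (s b) _) (m≤m+n _ _))) (sym p))
    start-injective (here refl) _ _ _ _ | no b≢a | no _ = ⊥-elim (b≢a refl)
    start-injective _ (here refl) _ _ _ | no _ | no b≢a′ = ⊥-elim (b≢a′ refl)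
    start-injective {b ∷ l} (there a∈) (there a′∈) x< x′< p | no _ | no _ =
      start-injective a∈ a′∈ x< x′<
        (+-cancelˡ-≡ (s b) _ _ (trans (sym (+-assoc (s b) _ _)) (trans p (+-assoc (s b) _ _))))

    -- Division with remainder for unequal blocks: lengths are subtracted until the remainder fits.
    -- Since `start` finds the first occurrence, the list must not repeat.
    locate : ∀ {l k} → Unique l → k < total s l → ∃₂ λ a x → a ∈ l × x < s a × start s l a + x ≡ k
    locate {b ∷ l} {k} (b∉l ∷ unique) k< with k <? s b
    ... | yes k<s = b , k , here refl , k<s , at-head
      where
      at-head : start s (b ∷ l) b + k ≡ k
      at-head with b ≟A b
      ... | yes _  = refl
      ... | no b≢b = ⊥-elim (b≢b refl)
    ... | no k≮s with a , x , a∈ , x< , p ← locate unique (+-cancelˡ-< (s b) (k ∸ s b) _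
                        (subst (_< s b + total s l) (sym (m+[n∸m]≡n (≮⇒≥ k≮s))) k<)) =
      a , x , there a∈ , x< , in-tail
      where
      in-tail : start s (b ∷ l) a + x ≡ k
      in-tail with b ≟A a
      ... | yes b≡a = ⊥-elim (All.lookup b∉l a∈ b≡a)
      ... | no _ = trans (+-assoc (s b) _ x) (trans (cong (s b +_) p) (m+[n∸m]≡n (≮⇒≥ k≮s)))

-- Assigns to each of `m` copies the model copy it imitates and its place within every block of that
-- model copy.
record Grouping (m : ℕ) {c : ℕ} (s : Fin c → ℕ) : Set where
  field
    group   : Fin m → Fin c
    offset  : Fin m → ℕ
    offset< : ∀ k → offset k < s (group k)
    unique  : ∀ {k l} → group k ≡ group l → offset k ≡ offset l → k ≡ l

open Grouping

module _ {m c : ℕ} {s : Fin c → ℕ} where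

  consecutive : m ≡ total s (allFin c) → Grouping m s
  consecutive m≡ = record
    { group   = proj₁ ∘ position
    ; offset  = proj₁ ∘ proj₂ ∘ position
    ; offset< = λ k → proj₁ (proj₂ (proj₂ (proj₂ (position k))))
    ; unique  = λ {k} {l} p q → toℕ-injective (trans (sym (value k))
                  (trans (cong₂ (λ τ x → start _≟_ s (allFin c) τ + x) p q) (value l)))
    }
    where
    position : (k : Fin m) → ∃₂ λ τ x → τ ∈ allFin c × x < s τ × start _≟_ s (allFin c) τ + x ≡ toℕ k
    position k = locate _≟_ s (allFin⁺ c) (subst (toℕ k <_) m≡ (toℕ<n k))

    value : ∀ k → start _≟_ s (allFin c) (proj₁ (position k)) + proj₁ (proj₂ (position k)) ≡ toℕ k
    value k = proj₂ (proj₂ (proj₂ (proj₂ (position k))))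

  -- Used on edges, so that the vertex and edge offsets of a copy in group `τ` add up to `s τ` - 1.
  reversed : Grouping m s → Grouping m s
  reversed γ = record
    { group   = group γ
    ; offset  = λ k → s (group γ k) ∸ suc (offset γ k)
    ; offset< = λ k → n∸1+m<n (offset< γ k)
    ; unique  = λ {k} {l} p q → unique γ p (suc-injective (∸-cancelˡ-≡ (offset< γ k)
                  (subst (offset γ l <_) (cong s (sym p)) (offset< γ l))
                  (trans q (cong (λ τ → s τ ∸ suc (offset γ l)) (sym p)))))
    }

  blocks : ∀ {R N} → Grouping m s → (_≟R_ : DecidableEquality (Fin c × R)) (l : List (Fin c × R)) →
           (∀ x → x ∈ l) → total (s ∘ proj₁) l ≡ N → Numbering (Fin m × R) N
  blocks {N = N} γ _≟R_ l all∈ N≡ = record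
    { number    = λ (k , r) → start _≟R_ (s ∘ proj₁) l (group γ k , r) + offset γ k
    ; bounded   = λ (k , r) → <-≤-trans (+-monoʳ-< (start _≟R_ (s ∘ proj₁) l (group γ k , r)) (offset< γ k))
                    (≤-trans (start-fits _≟R_ (s ∘ proj₁) (all∈ _)) (≤-reflexive N≡))
    ; injective = λ {(k , r)} {(k′ , r′)} p →
        let q , x≡ = start-injective _≟R_ (s ∘ proj₁) (all∈ _) (all∈ _) (offset< γ k) (offset< γ k′) p in
        cong₂ _,_ (unique γ (cong proj₁ q) x≡) (cong proj₂ q)
    }

-- Copies of K₄

module TripleWheels (t u m : ℕ) (m≡ : m ≡ 2 * t + 3 * u) (3≤3 : 3 ≤ 3) where

  α β : Fin 5 → ℕ
  α 0F = 1
  α 1F = 1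
  α _  = 0
  β τ = 1 ∸ α τ

  size₅ : Fin 5 → ℕ
  size₅ = combination α β t u

  -- Both orders come from a computer search.  Copies 0F and 1F stand for t wheels
  -- each, copies 2F, 3F and 4F for u wheels each; the position of a block is then
  -- a t + b u, and fan-starts and rim-starts check the coefficients of t and u
  -- separately.
  vertexOrder : List (Fin 5 × (⊤ ⊎ Fin 3))
  vertexOrder =
    hub 0F    ∷ hub 2F    ∷ rim 2F 0F ∷ hub 1F    ∷ rim 2F 1F ∷
    hub 3F    ∷ rim 1F 0F ∷ hub 4F    ∷ rim 0F 0F ∷ rim 2F 2F ∷
    rim 1F 1F ∷ rim 3F 0F ∷ rim 4F 0F ∷ rim 3F 1F ∷ rim 0F 1F ∷
    rim 3F 2F ∷ rim 0F 2F ∷ rim 4F 1F ∷ rim 4F 2F ∷ rim 1F 2F ∷ []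

  edgeOrder : List (Fin 5 × (Fin 3 ⊎ Fin 3))
  edgeOrder =
    arc 1F 1F   ∷ arc 4F 2F   ∷ arc 0F 0F   ∷ arc 3F 1F   ∷ spoke 4F 1F ∷
    spoke 0F 2F ∷ arc 4F 1F   ∷ arc 3F 2F   ∷ arc 0F 1F   ∷ spoke 3F 0F ∷
    spoke 1F 0F ∷ spoke 3F 1F ∷ arc 2F 2F   ∷ spoke 1F 2F ∷ spoke 4F 0F ∷
    spoke 2F 1F ∷ arc 1F 0F   ∷ arc 2F 1F   ∷ arc 4F 0F   ∷ spoke 0F 0F ∷
    spoke 4F 2F ∷ arc 1F 2F   ∷ spoke 2F 0F ∷ arc 3F 0F   ∷ arc 0F 2F   ∷
    spoke 3F 2F ∷ spoke 2F 2F ∷ spoke 1F 1F ∷ arc 2F 0F   ∷ spoke 0F 1F ∷ []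

  ∈vertexOrder : ∀ x → x ∈ vertexOrder
  ∈vertexOrder (τ , inj₁ tt) = from-yes (all? λ τ → hub τ ∈? vertexOrder) τ
    where open DecMembership _≟V_
  ∈vertexOrder (τ , inj₂ i) = from-yes (all? λ τ → all? λ i → rim τ i ∈? vertexOrder) τ i
    where open DecMembership _≟V_

  ∈edgeOrder : ∀ x → x ∈ edgeOrder
  ∈edgeOrder (τ , inj₁ i) = from-yes (all? λ τ → all? λ i → spoke τ i ∈? edgeOrder) τ i
    where open DecMembership _≟E_
  ∈edgeOrder (τ , inj₂ i) = from-yes (all? λ τ → all? λ i → arc τ i ∈? edgeOrder) τ i
    where open DecMembership _≟E_

  private
    quadruple : ∀ t u → 8 * t + 12 * u ≡ (2 * t + 3 * u) * 4
    quadruple = solve-∀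

    sextuple : ∀ t u → 12 * t + 18 * u ≡ (2 * t + 3 * u) * 6
    sextuple = solve-∀

  γ : Grouping m size₅
  γ = consecutive (trans m≡ (sym (total-combination α β t u (allFin 5))))

  onV : Numbering (Fin m × (⊤ ⊎ Fin 3)) (m * 4)
  onV = blocks γ _≟V_ vertexOrder ∈vertexOrder
    (trans (total-combination (α ∘ proj₁) (β ∘ proj₁) t u vertexOrder)
      (trans (quadruple t u) (cong (_* 4) (sym m≡))))

  onE : Numbering (Fin m × (Fin 3 ⊎ Fin 3)) (m * 6)
  onE = blocks (reversed γ) _≟E_ edgeOrder ∈edgeOrder
    (trans (total-combination (α ∘ proj₁) (β ∘ proj₁) t u edgeOrder)
      (trans (sextuple t u) (cong (_* 6) (sym m≡))))

  W₃ : ℕ → FiniteGraph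
  W₃ k = k · W 3 3≤3

  startV : (Fin 5 → ℕ) → Fin 5 × (⊤ ⊎ Fin 3) → ℕ
  startV s = start _≟V_ (s ∘ proj₁) vertexOrder

  startE : (Fin 5 → ℕ) → Fin 5 × (Fin 3 ⊎ Fin 3) → ℕ
  startE s = start _≟E_ (s ∘ proj₁) edgeOrder

  startSum : (Fin 5 → ℕ) → Triangle (FiniteGraph.graph (W₃ 5)) → ℕ
  startSum s = triangleSum (W₃ 5) (startV s) (startE s)

  fixed₃ : (i : Fin 3) → next (next (next i)) ≡ i
  fixed₃ = from-yes (all? λ (i : Fin 3) → next (next (next i)) ≟ i)

  -- The summands `3 * α τ` and `3 * β τ` anticipate the offsets, three on vertices and three on
  -- edges, which pair up to nearly three block lengths.
  fan-starts : ∀ τ i → startSum α (fan τ i) + 3 * α τ ≡ 30 × startSum β (fan τ i) + 3 * β τ ≡ 45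
  fan-starts τ i = from-yes (all? λ τ → all? λ i → startSum α (fan τ i) + 3 * α τ ℕ.≟ 30) τ i
                 , from-yes (all? λ τ → all? λ i → startSum β (fan τ i) + 3 * β τ ℕ.≟ 45) τ i

  rim-starts : ∀ τ i → startSum α (rimTriangle τ i (fixed₃ i)) + 3 * α τ ≡ 30 ×
                       startSum β (rimTriangle τ i (fixed₃ i)) + 3 * β τ ≡ 45
  rim-starts τ i = from-yes (all? λ τ → all? λ i → startSum α (rimTriangle τ i (fixed₃ i)) + 3 * α τ ℕ.≟ 30) τ i
                 , from-yes (all? λ τ → all? λ i → startSum β (rimTriangle τ i (fixed₃ i)) + 3 * β τ ℕ.≟ 45) τ i

  private
    -- The added 3 turns each offset pair into `x + suc y`, a full block length, and so avoids
    -- truncated subtraction.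
    regroup : ∀ t u a b c d e f a′ b′ c′ d′ e′ f′ x y →
      (((a * t + a′ * u) + x) + (((b * t + b′ * u) + x) + (((c * t + c′ * u) + x) + 0))) +
      (((d * t + d′ * u) + y) + (((e * t + e′ * u) + y) + (((f * t + f′ * u) + y) + 0))) + 3 ≡
      ((a + (b + (c + 0))) + (d + (e + (f + 0)))) * t +
      ((a′ + (b′ + (c′ + 0))) + (d′ + (e′ + (f′ + 0)))) * u + 3 * (x + suc y)
    regroup = solve-∀

    absorb : ∀ t u a b a′ b′ → a * t + b * u + 3 * (a′ * t + b′ * u) ≡ (a + 3 * a′) * t + (b + 3 * b′) * u
    absorb = solve-∀

    m+suc[n∸suc[m]]≡n : ∀ {m n} → m < n → m + suc (n ∸ suc m) ≡ n
    m+suc[n∸suc[m]]≡n {m} {n} m<n = trans (+-suc m _) (m+[n∸m]≡n m<n)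

  -- This is 15m - 3, as averaging forces: all vertices lie in equally many triangles, as do all
  -- edges, and the mean numbers are (4m - 1)/2 and (6m - 1)/2.
  magicSum : ℕ
  magicSum = 30 * t + 45 * u ∸ 3

  module _ (r₀ r₁ r₂ : ⊤ ⊎ Fin 3) (e₀ e₁ e₂ : Fin 3 ⊎ Fin 3) where

    -- A triangle given by its roles within a wheel can be read both in a model copy and in an
    -- actual copy.
    roleSum : ∀ {c} → (Fin c × (⊤ ⊎ Fin 3) → ℕ) → (Fin c × (Fin 3 ⊎ Fin 3) → ℕ) → Fin c → ℕ
    roleSum f g τ = (f (τ , r₀) + (f (τ , r₁) + (f (τ , r₂) + 0))) + (g (τ , e₀) + (g (τ , e₁) + (g (τ , e₂) + 0)))

    roleSum-magic : ∀ k → let τ = group γ k in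
                    roleSum (startV α) (startE α) τ + 3 * α τ ≡ 30 ×
                    roleSum (startV β) (startE β) τ + 3 * β τ ≡ 45 →
                    roleSum (number onV) (number onE) k ≡ magicSum
    roleSum-magic k (p , q) = m+n≡o⇒m≡o∸n (begin
      roleSum (number onV) (number onE) k + 3
        ≡⟨ cong (_+ 3) (cong₂ _+_
             (cong₂ _+_ (v≡ r₀) (cong₂ _+_ (v≡ r₁) (cong (_+ 0) (v≡ r₂))))
             (cong₂ _+_ (e≡ e₀) (cong₂ _+_ (e≡ e₁) (cong (_+ 0) (e≡ e₂))))) ⟩
      _ ≡⟨ regroup t u (v α r₀) (v α r₁) (v α r₂) (e α e₀) (e α e₁) (e α e₂)
                       (v β r₀) (v β r₁) (v β r₂) (e β e₀) (e β e₁) (e β e₂) x y ⟩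
      Σα * t + Σβ * u + 3 * (x + suc y)
        ≡⟨ cong (λ z → Σα * t + Σβ * u + 3 * z) (m+suc[n∸suc[m]]≡n (offset< γ k)) ⟩
      Σα * t + Σβ * u + 3 * size₅ τ
        ≡⟨ absorb t u Σα Σβ (α τ) (β τ) ⟩
      (Σα + 3 * α τ) * t + (Σβ + 3 * β τ) * u
        ≡⟨ cong₂ (λ a b → a * t + b * u) p q ⟩
      30 * t + 45 * u ∎)
      where
      open ≡-Reasoning
      τ  = group γ k
      x  = offset γ k
      y  = size₅ τ ∸ suc x
      Σα = roleSum (startV α) (startE α) τ
      Σβ = roleSum (startV β) (startE β) τ

      v : (Fin 5 → ℕ) → ⊤ ⊎ Fin 3 → ℕ
      v s r = startV s (τ , r)

      e : (Fin 5 → ℕ) → Fin 3 ⊎ Fin 3 → ℕ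
      e s r = startE s (τ , r)

      v≡ : ∀ r → v size₅ r + x ≡ (v α r * t + v β r * u) + x
      v≡ r = cong (_+ x) (start-combination _≟V_ (α ∘ proj₁) (β ∘ proj₁) t u vertexOrder (τ , r))

      e≡ : ∀ r → e size₅ r + y ≡ (e α r * t + e β r * u) + y
      e≡ r = cong (_+ y) (start-combination _≟E_ (α ∘ proj₁) (β ∘ proj₁) t u edgeOrder (τ , r))

      m+n≡o⇒m≡o∸n : ∀ {m n o} → m + n ≡ o → m ≡ o ∸ n
      m+n≡o⇒m≡o∸n {m} {n} p = trans (sym (m+n∸n≡m m n)) (cong (_∸ n) p)

  supermagic : IsSupermagic C₃ (W₃ m)
  supermagic = triangles⇒supermagic (W₃ m) _≟V_ _≟E_ fans-cover onV onE magicSum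
    (wheel-triangles {3≤n = 3≤3} (number onV) (number onE) magicSum
      (λ k i → roleSum-magic (inj₁ tt) (inj₂ i) (inj₂ (next i))
        (inj₁ i) (inj₂ i) (inj₁ (next i)) k (fan-starts (group γ k) i))
      (λ k i _ → roleSum-magic (inj₂ i) (inj₂ (next i)) (inj₂ (next (next i)))
        (inj₂ i) (inj₂ (next i)) (inj₂ (next (next i))) k (rim-starts (group γ k) i)))

-- The forms of `m` and `n`, and the two cases

twos-and-threes : ∀ m → 2 ≤ m → ∃₂ λ t u → m ≡ 2 * t + 3 * u
twos-and-threes 2 _ = 1 , 0 , refl
twos-and-threes 3 _ = 0 , 1 , refl
twos-and-threes (suc (suc (suc (suc m)))) _ with t , u , p ← twos-and-threes (suc (suc m)) (s≤s (s≤s z≤n)) =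
  suc t , u , trans (cong (2 +_) p) (cong (_+ 3 * u) (sym (*-suc 2 t)))
twos-and-threes 1 (s≤s ())

odd⇒1+q+q : ∀ n → n % 2 ≡ 1 → n ≡ suc (n / 2 + n / 2)
odd⇒1+q+q n odd = trans (m≡m%n+[m/n]*n n 2) (trans (cong (_+ n / 2 * 2) odd)
  (cong suc (trans (*-comm (n / 2) 2) (cong (n / 2 +_) (+-identityʳ (n / 2))))))

theorem5 : (n : ℕ) (3≤n : 3 ≤ n) → n % 2 ≡ 1 →
    (m : ℕ) → 2 ≤ m →
    IsSupermagic (C 3 ≤-refl) (m · W n 3≤n)
theorem5 n 3≤n odd m 2≤m with n ℕ.≟ 3
... | no n≢3 = OddWheels.supermagic m (n / 2) (odd⇒1+q+q n odd) 3≤n n≢3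
... | yes refl with t , u , m≡ ← twos-and-threes m 2≤m = TripleWheels.supermagic t u m m≡ 3≤n
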